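{- Let $M\ge 1$ be real and let $(a_n)_{n\ge1}$ be a sequence of real numbers. (1) The weak projection of the series $\sum_n a_n$ is absolutely convergent in $\mathbf{A}_{ -M,M}$, i.e. the sequence $\left(t\left(\sum_{n=1}^k |a_n|\right)\right)_{k\ge1}$ converges in $[-M,M]$. (2) If the series $\sum_n a_n$ is either convergent in $\mathbb{R}$, or divergent to $+\infty$, or divergent to $-\infty$, then its weak projection converges in $\mathbf{A}_{ -M,M}$, i.e. the sequence $\left(t\left(\sum_{n=1}^k a_n\right)\right)_{k\ge1}$ converges in $[-M,M]$.
   Context: $\mathbf{A}_{ -M,M}$ has underlying set $[-M,M]$ with the topology induced from $\mathbb{R}$. The coprojector $t:\mathbb{R}\to[-M,M]$ is given by $t(a)=a$ if $a\in[-M,M]$, $t(a)=M$ if $a>M$, and $t(a)=-M$ if $a<-M$. The weak projection of a series of real numbers onto $\mathbf{A}_{ -M,M}$ is the sequence of images under $t$ of its partial sums; it converges if this sequence has a limit in $[-M,M]$. It is absolutely convergent if the weak projection of the series of absolute values converges. -}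

module Defs where

open import Axiom.ExcludedMiddle using (ExcludedMiddle)
open import Data.Nat.Base as ℕ using (ℕ; zero; suc)
import Data.Nat.Properties as ℕ
open import Data.Product.Base using (Σ-syntax; ∃-syntax; _×_; _,_)
open import Data.Rational.Base as ℚ using (ℚ; 0ℚ; 1ℚ; ½)
import Data.Rational.Properties as ℚ
open import Data.Rational.Solver using (module +-*-Solver)
open import Data.Sum.Base using (_⊎_; inj₁; inj₂; [_,_]′)
open import Level using (0ℓ)
open import Relation.Binary.PropositionalEquality
  using (_≡_; refl; sym; trans; cong; cong₂; subst; subst₂)
open import Relation.Nullary using (yes; no; contradiction)

------------------------------------------------------------------------
-- Auxiliary facts about the rationals

½*-pos : ∀ {ε} → 0ℚ ℚ.< ε → 0ℚ ℚ.< ½ ℚ.* ε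
½*-pos {ε} 0<ε = subst (ℚ._< ½ ℚ.* ε) (ℚ.*-zeroʳ ½) (ℚ.*-monoʳ-<-pos ½ 0<ε)

halves : ∀ ε → ½ ℚ.* ε ℚ.+ ½ ℚ.* ε ≡ ε
halves = solve 1 (λ e → con ½ :* e :+ con ½ :* e := e) refl
  where open +-*-Solver

p≤∣p∣ : ∀ p → p ℚ.≤ ℚ.∣ p ∣
p≤∣p∣ p with ℚ.≤-total 0ℚ p
... | inj₁ 0≤p = ℚ.≤-reflexive (sym (ℚ.0≤p⇒∣p∣≡p 0≤p))
... | inj₂ p≤0 = ℚ.≤-trans p≤0 (ℚ.0≤∣p∣ p)

∣p-q∣≡∣q-p∣ : ∀ p q → ℚ.∣ p ℚ.- q ∣ ≡ ℚ.∣ q ℚ.- p ∣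
∣p-q∣≡∣q-p∣ p q =
  trans (cong ℚ.∣_∣ (solve 2 (λ p q → p :- q := :- (q :- p)) refl p q))
        (ℚ.∣-p∣≡∣p∣ (q ℚ.- p))
  where open +-*-Solver

∣p∣≤∣p-q∣+∣q∣ : ∀ p q → ℚ.∣ p ∣ ℚ.≤ ℚ.∣ p ℚ.- q ∣ ℚ.+ ℚ.∣ q ∣
∣p∣≤∣p-q∣+∣q∣ p q =
  subst (λ r → ℚ.∣ r ∣ ℚ.≤ ℚ.∣ p ℚ.- q ∣ ℚ.+ ℚ.∣ q ∣)
        (solve 2 (λ p q → (p :- q) :+ q := p) refl p q)
        (ℚ.∣p+q∣≤∣p∣+∣q∣ (p ℚ.- q) q)
  where open +-*-Solver

∣p∣-∣q∣≤∣p-q∣ : ∀ p q → ℚ.∣ p ∣ ℚ.- ℚ.∣ q ∣ ℚ.≤ ℚ.∣ p ℚ.- q ∣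
∣p∣-∣q∣≤∣p-q∣ p q =
  subst (ℚ.∣ p ∣ ℚ.- ℚ.∣ q ∣ ℚ.≤_)
        (solve 2 (λ a b → (a :+ b) :- b := a) refl ℚ.∣ p ℚ.- q ∣ ℚ.∣ q ∣)
        (ℚ.+-monoˡ-≤ (ℚ.- ℚ.∣ q ∣) (∣p∣≤∣p-q∣+∣q∣ p q))
  where open +-*-Solver

∣∣p∣-∣q∣∣≤∣p-q∣ : ∀ p q → ℚ.∣ ℚ.∣ p ∣ ℚ.- ℚ.∣ q ∣ ∣ ℚ.≤ ℚ.∣ p ℚ.- q ∣
∣∣p∣-∣q∣∣≤∣p-q∣ p q with ℚ.∣p∣≡p∨∣p∣≡-p (ℚ.∣ p ∣ ℚ.- ℚ.∣ q ∣)
... | inj₁ eq = subst (ℚ._≤ ℚ.∣ p ℚ.- q ∣) (sym eq) (∣p∣-∣q∣≤∣p-q∣ p q)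
... | inj₂ eq =
  subst₂ ℚ._≤_
    (trans (solve 2 (λ a b → b :- a := :- (a :- b)) refl ℚ.∣ p ∣ ℚ.∣ q ∣) (sym eq))
    (∣p-q∣≡∣q-p∣ q p)
    (∣p∣-∣q∣≤∣p-q∣ q p)
  where open +-*-Solver

------------------------------------------------------------------------
-- Real numbers as Cauchy sequences of rationals. Equality of reals is
-- not _≡_ but the equivalence x ≤ y × y ≤ x for the order below, i.e.
-- seq x n - seq y n tends to 0. Excluded middle is taken as an explicit
-- argument wherever the mathematics is classical.

Cauchy : (ℕ → ℚ) → Set
Cauchy s = ∀ ε → 0ℚ ℚ.< ε →
  ∃[ N ] (∀ m n → N ℕ.≤ m → N ℕ.≤ n → ℚ.∣ s m ℚ.- s n ∣ ℚ.< ε)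

record ℝ : Set where
  constructor mkℝ
  field
    seq    : ℕ → ℚ
    cauchy : Cauchy seq

open ℝ public

fromℚ : ℚ → ℝ
fromℚ q = mkℝ (λ _ → q) λ ε 0<ε →
  0 , λ _ _ _ _ → subst (ℚ._< ε) (sym (cong ℚ.∣_∣ (ℚ.+-inverseʳ q))) 0<ε

0ℝ 1ℝ : ℝ
0ℝ = fromℚ 0ℚ
1ℝ = fromℚ 1ℚ

infixl 6 _+_ _-_
infix  8 -_
infix  4 _<_ _≤_

_+_ : ℝ → ℝ → ℝ
x + y = mkℝ (λ n → seq x n ℚ.+ seq y n) λ ε 0<ε →
  let h≥0       = ½*-pos 0<ε
      (N₁ , p₁) = cauchy x (½ ℚ.* ε) h≥0
      (N₂ , p₂) = cauchy y (½ ℚ.* ε) h≥0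
  in N₁ ℕ.⊔ N₂ , λ m n N≤m N≤n →
    let xm = seq x m ; xn = seq x n ; ym = seq y m ; yn = seq y n in
    ℚ.≤-<-trans
      (subst (λ r → ℚ.∣ r ∣ ℚ.≤ ℚ.∣ xm ℚ.- xn ∣ ℚ.+ ℚ.∣ ym ℚ.- yn ∣)
             (rearrange xm xn ym yn)
             (ℚ.∣p+q∣≤∣p∣+∣q∣ (xm ℚ.- xn) (ym ℚ.- yn)))
      (subst (ℚ.∣ xm ℚ.- xn ∣ ℚ.+ ℚ.∣ ym ℚ.- yn ∣ ℚ.<_) (halves ε)
        (ℚ.+-mono-<
          (p₁ m n (ℕ.m⊔n≤o⇒m≤o N₁ N₂ N≤m) (ℕ.m⊔n≤o⇒m≤o N₁ N₂ N≤n))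
          (p₂ m n (ℕ.m⊔n≤o⇒n≤o N₁ N₂ N≤m) (ℕ.m⊔n≤o⇒n≤o N₁ N₂ N≤n))))
  where
  open +-*-Solver
  rearrange : ∀ a b c d →
    (a ℚ.- b) ℚ.+ (c ℚ.- d) ≡ (a ℚ.+ c) ℚ.- (b ℚ.+ d)
  rearrange = solve 4 (λ a b c d → (a :- b) :+ (c :- d) := (a :+ c) :- (b :+ d)) refl

-_ : ℝ → ℝ
- x = mkℝ (λ n → ℚ.- seq x n) λ ε 0<ε →
  let (N , p) = cauchy x ε 0<ε
  in N , λ m n N≤m N≤n →
    subst (ℚ._< ε)
      (trans (∣p-q∣≡∣q-p∣ (seq x m) (seq x n))
             (cong ℚ.∣_∣ (flip (seq x n) (seq x m))))
      (p m n N≤m N≤n)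
  where
  open +-*-Solver
  flip : ∀ a b → a ℚ.- b ≡ (ℚ.- b) ℚ.- (ℚ.- a)
  flip = solve 2 (λ a b → a :- b := (:- b) :- (:- a)) refl

_-_ : ℝ → ℝ → ℝ
x - y = x + (- y)

∣_∣ : ℝ → ℝ
∣ x ∣ = mkℝ (λ n → ℚ.∣ seq x n ∣) λ ε 0<ε →
  let (N , p) = cauchy x ε 0<ε
  in N , λ m n N≤m N≤n →
    ℚ.≤-<-trans (∣∣p∣-∣q∣∣≤∣p-q∣ (seq x m) (seq x n)) (p m n N≤m N≤n)

_<_ : ℝ → ℝ → Set
x < y = ∃[ ε ] (0ℚ ℚ.< ε ×
  ∃[ N ] (∀ n → N ℕ.≤ n → seq x n ℚ.+ ε ℚ.≤ seq y n))

_≤_ : ℝ → ℝ → Set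
x ≤ y = ∀ ε → 0ℚ ℚ.< ε →
  ∃[ N ] (∀ n → N ℕ.≤ n → seq x n ℚ.≤ seq y n ℚ.+ ε)

≤-refl : ∀ x → x ≤ x
≤-refl x ε 0<ε = 0 , λ n _ →
  subst (ℚ._≤ seq x n ℚ.+ ε) (ℚ.+-identityʳ (seq x n))
        (ℚ.+-monoʳ-≤ (seq x n) (ℚ.<⇒≤ 0<ε))

-- If the two sequences, once settled up to δ = ε/8, satisfy
-- seq y N ≤ seq x N + 3δ, then y ≤ x up to ε; otherwise x < y with gap δ.

opaque
  <-≤-total : ExcludedMiddle 0ℓ → ∀ x y → x < y ⊎ y ≤ x
  <-≤-total em x y with em {x < y}
  ... | yes x<y = inj₁ x<y
  ... | no  x≮y = inj₂ λ ε 0<ε →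
    let δ         = ½ ℚ.* (½ ℚ.* (½ ℚ.* ε))
        0<δ       = ½*-pos (½*-pos (½*-pos 0<ε))
        (N₁ , p₁) = cauchy x δ 0<δ
        (N₂ , p₂) = cauchy y δ 0<δ
        N         = N₁ ℕ.⊔ N₂
        xN        = seq x N
        yN        = seq y N
        3δ        = δ ℚ.+ δ ℚ.+ δ
        inN₁ : ∀ {n} → N ℕ.≤ n → N₁ ℕ.≤ n
        inN₁      = ℕ.m⊔n≤o⇒m≤o N₁ N₂
        inN₂ : ∀ {n} → N ℕ.≤ n → N₂ ℕ.≤ n
        inN₂      = ℕ.m⊔n≤o⇒n≤o N₁ N₂
        x-near : ∀ n → N ℕ.≤ n → ℚ.∣ seq x n ℚ.- xN ∣ ℚ.< δ
        x-near n N≤n = p₁ n N (inN₁ N≤n) (inN₁ ℕ.≤-refl)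
        y-near : ∀ n → N ℕ.≤ n → ℚ.∣ seq y n ℚ.- yN ∣ ℚ.< δ
        y-near n N≤n = p₂ n N (inN₂ N≤n) (inN₂ ℕ.≤-refl)
        below : yN ℚ.≤ xN ℚ.+ 3δ → ∀ n → N ℕ.≤ n → seq y n ℚ.≤ seq x n ℚ.+ ε
        below yN≤ n N≤n =
          ℚ.≤-trans (close (seq y n) yN (y-near n N≤n))
          (ℚ.≤-trans (ℚ.+-monoˡ-≤ δ
            (ℚ.≤-trans yN≤ (ℚ.+-monoˡ-≤ 3δ (close′ (seq x n) xN (x-near n N≤n)))))
          (ℚ.≤-trans (slack 0<δ (seq x n)) (ℚ.≤-reflexive (eight (seq x n) ε))))
        above : xN ℚ.+ 3δ ℚ.≤ yN → ∀ n → N ℕ.≤ n → seq x n ℚ.+ δ ℚ.≤ seq y n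
        above ≤yN n N≤n = cancel (seq x n) (seq y n) δ
          (ℚ.≤-trans (ℚ.+-monoˡ-≤ (δ ℚ.+ δ) (close (seq x n) xN (x-near n N≤n)))
          (ℚ.≤-trans (ℚ.≤-reflexive (regroup xN δ))
                     (ℚ.≤-trans ≤yN (close′ (seq y n) yN (y-near n N≤n)))))
    in N , [ below
           , (λ ≤yN → contradiction (δ , 0<δ , N , above ≤yN) x≮y) ]′
           (ℚ.≤-total yN (xN ℚ.+ 3δ))
    where
    open +-*-Solver
    close : ∀ p q {δ} → ℚ.∣ p ℚ.- q ∣ ℚ.< δ → p ℚ.≤ q ℚ.+ δ
    close p q h =
      subst (ℚ._≤ q ℚ.+ _) (solve 2 (λ p q → q :+ (p :- q) := p) refl p q)
        (ℚ.+-monoʳ-≤ q (ℚ.≤-trans (p≤∣p∣ (p ℚ.- q)) (ℚ.<⇒≤ h)))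

    close′ : ∀ p q {δ} → ℚ.∣ p ℚ.- q ∣ ℚ.< δ → q ℚ.≤ p ℚ.+ δ
    close′ p q {δ} h = close q p (subst (ℚ._< δ) (∣p-q∣≡∣q-p∣ p q) h)

    regroup : ∀ a d → a ℚ.+ d ℚ.+ (d ℚ.+ d) ≡ a ℚ.+ (d ℚ.+ d ℚ.+ d)
    regroup = solve 2 (λ a d → a :+ d :+ (d :+ d) := a :+ (d :+ d :+ d)) refl

    cancel : ∀ a b d → a ℚ.+ (d ℚ.+ d) ℚ.≤ b ℚ.+ d → a ℚ.+ d ℚ.≤ b
    cancel a b d h = subst₂ ℚ._≤_
      (solve 2 (λ a d → a :+ (d :+ d) :- d := a :+ d) refl a d)
      (solve 2 (λ b d → b :+ d :- d := b) refl b d)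
      (ℚ.+-monoˡ-≤ (ℚ.- d) h)

    slack : ∀ {d} → 0ℚ ℚ.< d → ∀ a →
      a ℚ.+ d ℚ.+ (d ℚ.+ d ℚ.+ d) ℚ.+ d ℚ.≤
      a ℚ.+ d ℚ.+ (d ℚ.+ d ℚ.+ d) ℚ.+ d ℚ.+ (d ℚ.+ d ℚ.+ d)
    slack {d} 0<d a =
      subst (ℚ._≤ b ℚ.+ (d ℚ.+ d ℚ.+ d)) (ℚ.+-identityʳ b)
        (ℚ.+-monoʳ-≤ b (ℚ.+-mono-≤ (ℚ.+-mono-≤ 0≤d 0≤d) 0≤d))
      where
      b : ℚ
      b = a ℚ.+ d ℚ.+ (d ℚ.+ d ℚ.+ d) ℚ.+ d
      0≤d : 0ℚ ℚ.≤ d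
      0≤d = ℚ.<⇒≤ 0<d

    eight : ∀ a ε → let d = ½ ℚ.* (½ ℚ.* (½ ℚ.* ε)) in
      a ℚ.+ d ℚ.+ (d ℚ.+ d ℚ.+ d) ℚ.+ d ℚ.+ (d ℚ.+ d ℚ.+ d) ≡ a ℚ.+ ε
    eight = solve 2 (λ a e → let d = con ½ :* (con ½ :* (con ½ :* e)) in
      a :+ d :+ (d :+ d :+ d) :+ d :+ (d :+ d :+ d) := a :+ e) refl

------------------------------------------------------------------------
-- Sequences and series of real numbers. A series Σ_{n≥1} aₙ is given by
-- a : ℕ → ℝ with a i standing for a_{i+1}, and partialSum a i is the
-- partial sum a₁ + ⋯ + a_{i+1}.

_⟶_ : (ℕ → ℝ) → ℝ → Set
s ⟶ l = ∀ ε → 0ℝ < ε → ∃[ N ] (∀ k → N ℕ.≤ k → ∣ s k - l ∣ < ε)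

partialSum : (ℕ → ℝ) → ℕ → ℝ
partialSum a zero    = a zero
partialSum a (suc k) = partialSum a k + a (suc k)

SeriesConverges : (ℕ → ℝ) → Set
SeriesConverges a = ∃[ l ] (partialSum a ⟶ l)

SeriesDivergesTo+∞ : (ℕ → ℝ) → Set
SeriesDivergesTo+∞ a = ∀ B → ∃[ N ] (∀ k → N ℕ.≤ k → B < partialSum a k)

SeriesDivergesTo-∞ : (ℕ → ℝ) → Set
SeriesDivergesTo-∞ a = ∀ B → ∃[ N ] (∀ k → N ℕ.≤ k → partialSum a k < B)

------------------------------------------------------------------------
-- The space A_{-M,M} and weak projections

record 𝐀 (M : ℝ) : Set where
  constructor mk𝐀
  field
    value : ℝ
    lower : - M ≤ value
    upper : value ≤ M

open 𝐀 public

-- Convergence for the topology induced from ℝ.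

_⟶ᴬ_ : {M : ℝ} → (ℕ → 𝐀 M) → 𝐀 M → Set
s ⟶ᴬ l = (λ k → value (s k)) ⟶ value l

Convergesᴬ : {M : ℝ} → (ℕ → 𝐀 M) → Set
Convergesᴬ {M} s = Σ[ l ∈ 𝐀 M ] (s ⟶ᴬ l)

opaque
  -M≤M : ∀ {M} → 1ℝ ≤ M → - M ≤ M
  -M≤M {M} 1≤M ε 0<ε =
    let (N , p) = 1≤M 1ℚ (ℚ.positive⁻¹ 1ℚ)
    in N , λ n N≤n →
      let 0≤m = subst₂ ℚ._≤_ (ℚ.+-inverseʳ 1ℚ) (cancel (seq M n))
                  (ℚ.+-monoˡ-≤ (ℚ.- 1ℚ) (p n N≤n))
      in ℚ.≤-trans (ℚ.neg-antimono-≤ 0≤m)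
         (subst (ℚ._≤ seq M n ℚ.+ ε) (ℚ.+-identityʳ 0ℚ)
           (ℚ.+-mono-≤ 0≤m (ℚ.<⇒≤ 0<ε)))
    where
    open +-*-Solver
    cancel : ∀ m → m ℚ.+ 1ℚ ℚ.- 1ℚ ≡ m
    cancel = solve 1 (λ m → m :+ con 1ℚ :- con 1ℚ := m) refl

data Position (M a : ℝ) : Set where
  inside : - M ≤ a → a ≤ M → Position M a
  above  : M < a → Position M a
  below  : a < - M → Position M a

position : ExcludedMiddle 0ℓ → ∀ M a → Position M a
position em M a = decide (<-≤-total em M a) (<-≤-total em a (- M))
  where
  decide : M < a ⊎ a ≤ M → a < - M ⊎ - M ≤ a → Position M a
  decide (inj₁ M<a) _           = above M<a
  decide (inj₂ a≤M) (inj₁ a<-M) = below a<-M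
  decide (inj₂ a≤M) (inj₂ -M≤a) = inside -M≤a a≤M

-- Here 1 ≤ M only serves to place ±M in [-M, M].

project : ∀ {M a} → 1ℝ ≤ M → Position M a → 𝐀 M
project {M} {a} _   (inside -M≤a a≤M) = mk𝐀 a -M≤a a≤M
project {M} {a} 1≤M (above _)         = mk𝐀 M (-M≤M {M} 1≤M) (≤-refl M)
project {M} {a} 1≤M (below _)         = mk𝐀 (- M) (≤-refl (- M)) (-M≤M {M} 1≤M)

coprojector : ExcludedMiddle 0ℓ → (M : ℝ) → 1ℝ ≤ M → ℝ → 𝐀 M
coprojector em M 1≤M a = project 1≤M (position em M a)

weakProjection : ExcludedMiddle 0ℓ → (M : ℝ) → 1ℝ ≤ M → (ℕ → ℝ) → ℕ → 𝐀 M
weakProjection em M 1≤M a k = coprojector em M 1≤M (partialSum a k)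

WeakProjectionConverges : ExcludedMiddle 0ℓ → (M : ℝ) → 1ℝ ≤ M → (ℕ → ℝ) → Set
WeakProjectionConverges em M 1≤M a = Convergesᴬ (weakProjection em M 1≤M a)

WeakProjectionConvergesAbsolutely :
  ExcludedMiddle 0ℓ → (M : ℝ) → 1ℝ ≤ M → (ℕ → ℝ) → Set
WeakProjectionConvergesAbsolutely em M 1≤M a =
  WeakProjectionConverges em M 1≤M (λ n → ∣ a n ∣)

-- The coprojector is monotone and 1-Lipschitz, so it carries convergent series to
-- convergent weak projections; and it is constantly ±M beyond ±M, which settles
-- divergence to ±∞. Part (1) is the case of Σ|aₙ|, whose partial sums increase and
-- hence either converge or diverge to +∞.

{-# OPTIONS --safe #-}
module Submission where

open import Defs
open import Axiom.ExcludedMiddle using (ExcludedMiddle)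
open import Data.Nat.Base using (ℕ)
open import Data.Product.Base using (_×_)
open import Data.Sum.Base using (_⊎_)
open import Level using (0ℓ)

open import Algebra.Bundles using (CommutativeRing)
import Algebra.Properties.Semiring.Mult as Mult
open import Data.Integer.Base as ℤ using (+_; +[1+_]; -[1+_])
import Data.Integer.Properties as ℤ
open import Data.Nat.Base as ℕ using (zero; suc)
open import Data.Nat.Coprimality as Coprimality using (1-coprimeTo)
import Data.Nat.Properties as ℕ
open import Data.Product.Base using (∃-syntax; _,_; proj₁; proj₂)
open import Data.Rational.Base as ℚ using (ℚ; mkℚ; 0ℚ; 1ℚ; ½)
import Data.Rational.Properties as ℚ
open import Data.Rational.Solver using (module +-*-Solver)
import Data.Rational.Unnormalised.Base as ℚᵘ
import Data.Rational.Unnormalised.Properties as ℚᵘ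
open import Data.Sum.Base using (inj₁; inj₂; [_,_]′)
open import Relation.Binary.PropositionalEquality
  using (_≡_; refl; sym; trans; cong; subst; subst₂)
open import Relation.Nullary using (¬_; yes; no; contradiction)

open +-*-Solver
open Mult (CommutativeRing.semiring ℚ.+-*-commutativeRing)
  using (×-assoc-*) renaming (_×_ to _·_)

-- Rational numbers

-- A linear consequence of p ≤ q is reduced to an identity for the ring solver.
≤-rearrange : ∀ {p q p′ q′} → p ℚ.≤ q → p′ ℚ.+ q ≡ p ℚ.+ q′ → p′ ℚ.≤ q′
≤-rearrange {p} {q} {p′} {q′} p≤q eq = subst₂ ℚ._≤_
  (solve 2 (λ p p′ → p :+ (p′ :- p) := p′) refl p p′)
  (trans (solve 3 (λ p q p′ → q :+ (p′ :- p) := p′ :+ q :- p) refl p q p′)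
  (trans (cong (ℚ._- p) eq)
         (solve 2 (λ p q′ → p :+ q′ :- p := q′) refl p q′)))
  (ℚ.+-monoˡ-≤ (p′ ℚ.- p) p≤q)

p≤p+q : ∀ p {q} → 0ℚ ℚ.≤ q → p ℚ.≤ p ℚ.+ q
p≤p+q p {q} 0≤q = ≤-rearrange 0≤q (solve 2 (λ p q → p :+ q := con 0ℚ :+ (p :+ q)) refl p q)

∣p-q∣≤r : ∀ p q r → p ℚ.≤ q ℚ.+ r → q ℚ.≤ p ℚ.+ r → ℚ.∣ p ℚ.- q ∣ ℚ.≤ r
∣p-q∣≤r p q r p≤q+r q≤p+r with ℚ.∣p∣≡p∨∣p∣≡-p (p ℚ.- q)
... | inj₁ eq = subst (ℚ._≤ r) (sym eq)
  (≤-rearrange p≤q+r (solve 3 (λ p q r → p :- q :+ (q :+ r) := p :+ r) refl p q r))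
... | inj₂ eq = subst (ℚ._≤ r) (sym eq)
  (≤-rearrange q≤p+r (solve 3 (λ p q r → :- (p :- q) :+ (p :+ r) := q :+ r) refl p q r))

∣p-q∣≤r⇒p≤q+r : ∀ p q r → ℚ.∣ p ℚ.- q ∣ ℚ.≤ r → p ℚ.≤ q ℚ.+ r
∣p-q∣≤r⇒p≤q+r p q r h =
  ≤-rearrange (ℚ.≤-trans (p≤∣p∣ (p ℚ.- q)) h)
    (solve 3 (λ p q r → p :+ r := p :- q :+ (q :+ r)) refl p q r)

-- Archimedean property of the rationals

-- Given in lowest terms, so that comparison with another fraction is a comparison of integers;
-- `fromℕ≡·1` relates it to iterated addition.
fromℕ : ℕ → ℚ
fromℕ n = mkℚ (+ n) 0 (Coprimality.sym (1-coprimeTo n))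

fromℕ-suc : ∀ n → fromℕ (suc n) ≡ 1ℚ ℚ.+ fromℕ n
fromℕ-suc n = ℚ.toℚᵘ-injective (ℚᵘ.≃-trans
  (ℚᵘ.*≡* (cong (λ m → (+ 1 ℤ.+ m) ℤ.* + 1) (sym (ℤ.*-identityʳ (+ n)))))
  (ℚᵘ.≃-sym (ℚ.toℚᵘ-homo-+ 1ℚ (fromℕ n))))

fromℕ≡·1 : ∀ n → fromℕ n ≡ n · 1ℚ
fromℕ≡·1 zero    = refl
fromℕ≡·1 (suc n) = trans (fromℕ-suc n) (cong (1ℚ ℚ.+_) (fromℕ≡·1 n))

-- A nonnegative fraction is at most its numerator, since its denominator is at least 1; a negative
-- one lies below 0.
≤-fromℕ : ∀ p → ∃[ n ] (p ℚ.≤ fromℕ n)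
≤-fromℕ (mkℚ (+ n) d _) = n , ℚ.*≤* (ℤ.*-monoˡ-≤-nonNeg (+ n) (ℤ.+≤+ (ℕ.s≤s ℕ.z≤n)))
≤-fromℕ (mkℚ -[1+ n ] d _) = 0 , ℚ.*≤* ℤ.-≤+

-- Bound `p / ε` by a natural number and multiply by `ε`. The multiple is an iterated sum, so that
-- an induction on `n` can remove one `ε` at a time.
archimedean : ∀ {ε} → 0ℚ ℚ.< ε → ∀ p → ∃[ n ] (p ℚ.≤ n · ε)
archimedean {ε} 0<ε p = proj₁ bound , subst₂ ℚ._≤_ p/ε*ε≡p n*ε≡n·ε
  (ℚ.*-monoʳ-≤-nonNeg ε (proj₂ bound))
  where
  instance
    ε-pos : ℚ.Positive ε
    ε-pos = ℚ.positive 0<ε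
    ε-nonNeg : ℚ.NonNegative ε
    ε-nonNeg = ℚ.pos⇒nonNeg ε
    ε≢0 : ℚ.NonZero ε
    ε≢0 = ℚ.pos⇒nonZero ε
  bound : ∃[ n ] (p ℚ.* ℚ.1/ ε ℚ.≤ fromℕ n)
  bound = ≤-fromℕ (p ℚ.* ℚ.1/ ε)
  p/ε*ε≡p : p ℚ.* ℚ.1/ ε ℚ.* ε ≡ p
  p/ε*ε≡p = trans (ℚ.*-assoc p (ℚ.1/ ε) ε)
    (trans (cong (p ℚ.*_) (ℚ.*-inverseˡ ε)) (ℚ.*-identityʳ p))
  n*ε≡n·ε : fromℕ (proj₁ bound) ℚ.* ε ≡ proj₁ bound · ε
  n*ε≡n·ε = trans (cong (ℚ._* ε) (fromℕ≡·1 (proj₁ bound)))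
    (trans (×-assoc-* (proj₁ bound) 1ℚ ε) (cong (proj₁ bound ·_) (ℚ.*-identityˡ ε)))

1/suc : ℕ → ℚ
1/suc n = mkℚ (+ 1) n (1-coprimeTo (suc n))

1/suc-pos : ∀ n → 0ℚ ℚ.< 1/suc n
1/suc-pos n = ℚ.positive⁻¹ (1/suc n)

1/suc-anti-≤ : ∀ {m n} → m ℕ.≤ n → 1/suc n ℚ.≤ 1/suc m
1/suc-anti-≤ m≤n = ℚ.*≤* (ℤ.*-monoˡ-≤-nonNeg (+ 1) (ℤ.+≤+ (ℕ.s≤s m≤n)))

-- A positive fraction has numerator at least 1, so it is at least the reciprocal of its own
-- denominator `suc d`.
1/suc-small : ∀ {ε} → 0ℚ ℚ.< ε → ∃[ n ] (1/suc n ℚ.≤ ε)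
1/suc-small {mkℚ +[1+ a ] d _} _ = d ,
  ℚ.*≤* (ℤ.*-monoʳ-≤-nonNeg (+ suc d) {+ 1} {+[1+ a ]} (ℤ.+≤+ (ℕ.s≤s ℕ.z≤n)))
1/suc-small {mkℚ (+ 0) d _} (ℚ.*<* (ℤ.+<+ ()))
1/suc-small {mkℚ -[1+ _ ] d _} (ℚ.*<* ())

-- Order on the real numbers

pointwise-≤ : ∀ x y → (∀ n → seq x n ℚ.≤ seq y n) → x ≤ y
pointwise-≤ x y h ε 0<ε = 0 , λ n _ → ℚ.≤-trans (h n) (p≤p+q (seq y n) (ℚ.<⇒≤ 0<ε))

≤-trans : ∀ x y z → x ≤ y → y ≤ z → x ≤ z
≤-trans x y z x≤y y≤z ε 0<ε =
  let (N₁ , p₁) = x≤y (½ ℚ.* ε) (½*-pos 0<ε)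
      (N₂ , p₂) = y≤z (½ ℚ.* ε) (½*-pos 0<ε)
  in N₁ ℕ.⊔ N₂ , λ n N≤n →
    ≤-rearrange (ℚ.+-mono-≤ (p₁ n (ℕ.m⊔n≤o⇒m≤o N₁ N₂ N≤n)) (p₂ n (ℕ.m⊔n≤o⇒n≤o N₁ N₂ N≤n)))
      (solve 4 (λ x y z e → x :+ (y :+ con ½ :* e :+ (z :+ con ½ :* e)) := x :+ y :+ (z :+ e))
        refl (seq x n) (seq y n) (seq z n) ε)

<⇒≤ : ∀ x y → x < y → x ≤ y
<⇒≤ x y (δ , 0<δ , N , p) ε 0<ε = N , λ n N≤n →
  ℚ.≤-trans (p≤p+q (seq x n) (ℚ.<⇒≤ 0<δ))
  (ℚ.≤-trans (p n N≤n) (p≤p+q (seq y n) (ℚ.<⇒≤ 0<ε)))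

<-≤-trans : ∀ x y z → x < y → y ≤ z → x < z
<-≤-trans x y z (ε , 0<ε , N₁ , p₁) y≤z =
  let (N₂ , p₂) = y≤z (½ ℚ.* ε) (½*-pos 0<ε)
  in ½ ℚ.* ε , ½*-pos 0<ε , N₁ ℕ.⊔ N₂ , λ n N≤n →
    ≤-rearrange (ℚ.+-mono-≤ (p₁ n (ℕ.m⊔n≤o⇒m≤o N₁ N₂ N≤n)) (p₂ n (ℕ.m⊔n≤o⇒n≤o N₁ N₂ N≤n)))
      (solve 4 (λ x y z e → x :+ con ½ :* e :+ (y :+ (z :+ con ½ :* e)) := x :+ e :+ y :+ z)
        refl (seq x n) (seq y n) (seq z n) ε)

+-monoˡ-≤ : ∀ x y z → x ≤ y → x + z ≤ y + z
+-monoˡ-≤ x y z x≤y ε 0<ε =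
  let (N , p) = x≤y ε 0<ε in N , λ n N≤n →
    ≤-rearrange (p n N≤n)
      (solve 4 (λ x y z e → x :+ z :+ (y :+ e) := x :+ (y :+ z :+ e))
        refl (seq x n) (seq y n) (seq z n) ε)

x≤x+q : ∀ x {q} → 0ℚ ℚ.≤ q → x ≤ x + fromℚ q
x≤x+q x {q} 0≤q = pointwise-≤ x (x + fromℚ q) λ n → p≤p+q (seq x n) 0≤q

x≤y⇒x≤y+q : ∀ x y {q} → 0ℚ ℚ.≤ q → x ≤ y → x ≤ y + fromℚ q
x≤y⇒x≤y+q x y {q} 0≤q x≤y = ≤-trans x y (y + fromℚ q) x≤y (x≤x+q y 0≤q)

-- Limits

-- The condition that the distance of `x` and `y` is at most `ε`, split into two one-sided bounds
-- that can be proved and chained separately.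
Near : ℚ → ℝ → ℝ → Set
Near ε x y = x ≤ y + fromℚ ε × y ≤ x + fromℚ ε

Near-sym : ∀ {ε} x y → Near ε x y → Near ε y x
Near-sym x y (p , q) = q , p

Near-trans : ∀ {δ ε} x y z → Near δ x y → Near ε y z → Near (δ ℚ.+ ε) x z
Near-trans {δ} {ε} x y z (x≤y , y≤x) (y≤z , z≤y) =
  chain x y z δ ε (δ ℚ.+ ε) (ℚ.+-comm ε δ) x≤y y≤z ,
  chain z y x ε δ (δ ℚ.+ ε) refl z≤y y≤x
  where
  -- The two directions add the tolerances in opposite orders, so the total is fixed only up to an
  -- equation.
  chain : ∀ x y z α β γ → β ℚ.+ α ≡ γ →
    x ≤ y + fromℚ α → y ≤ z + fromℚ β → x ≤ z + fromℚ γ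
  chain x y z α β _ refl p q =
    ≤-trans x (y + fromℚ α) (z + fromℚ (β ℚ.+ α)) p
      (≤-trans (y + fromℚ α) (z + fromℚ β + fromℚ α) (z + fromℚ (β ℚ.+ α))
        (+-monoˡ-≤ y (z + fromℚ β) (fromℚ α) q)
        (pointwise-≤ (z + fromℚ β + fromℚ α) (z + fromℚ (β ℚ.+ α))
          λ n → ℚ.≤-reflexive (ℚ.+-assoc (seq z n) β α)))

Near-weaken : ∀ {δ ε} x y → δ ℚ.≤ ε → Near δ x y → Near ε x y
Near-weaken {δ} {ε} x y δ≤ε (p , q) =
  ≤-trans x (y + fromℚ δ) (y + fromℚ ε) p (grow y) ,
  ≤-trans y (x + fromℚ δ) (x + fromℚ ε) q (grow x)
  where
  grow : ∀ z → z + fromℚ δ ≤ z + fromℚ ε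
  grow z = pointwise-≤ (z + fromℚ δ) (z + fromℚ ε) λ n → ℚ.+-monoʳ-≤ (seq z n) δ≤ε

-- The order on reals allows every positive slack; if `q < p`, the slack `(p - q)/2` is already too
-- small.
fromℚ-cancel-≤ : ∀ p q → fromℚ p ≤ fromℚ q → p ℚ.≤ q
fromℚ-cancel-≤ p q h = ℚ.≮⇒≥ absurd
  where
  absurd : ¬ (q ℚ.< p)
  absurd q<p =
    let 0<p-q   = subst (ℚ._< p ℚ.- q) (ℚ.+-inverseʳ q) (ℚ.+-monoˡ-< (ℚ.- q) q<p)
        (N , r) = h (½ ℚ.* (p ℚ.- q)) (½*-pos 0<p-q)
        half≤0  = ≤-rearrange {p′ = ½ ℚ.* (p ℚ.- q)} {q′ = 0ℚ} (r N ℕ.≤-refl)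
          (solve 2 (λ p q → con ½ :* (p :- q) :+ (q :+ con ½ :* (p :- q)) := p :+ con 0ℚ) refl p q)
    in ℚ.<-irrefl refl (ℚ.<-≤-trans (½*-pos 0<p-q) half≤0)

⟶-intro : ∀ s l → (∀ ε → 0ℚ ℚ.< ε → ∃[ N ] (∀ k → N ℕ.≤ k → Near ε (s k) l)) → s ⟶ l
⟶-intro s l h ε (ε₀ , 0<ε₀ , N₀ , p₀) =
  -- The rational `ε₀` witnesses that `ε` is positive. One `η` is the tolerance of `Near` and
  -- another the slack in `≤`; together they use half of `ε₀`, and the other half is the gap of the
  -- strict inequality.
  let η       = ½ ℚ.* (½ ℚ.* ε₀)
      0<η     = ½*-pos (½*-pos 0<ε₀)
      (N , p) = h η 0<η
  in N , λ k N≤k →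
    let (N₁ , p₁) = proj₁ (p k N≤k) η 0<η
        (N₂ , p₂) = proj₂ (p k N≤k) η 0<η
        N₁₂       = N₁ ℕ.⊔ N₂
    in ½ ℚ.* ε₀ , ½*-pos 0<ε₀ , N₀ ℕ.⊔ N₁₂ , λ n N≤n →
      let x = seq (s k) n
          y = seq l n
          in₁₂ = ℕ.m⊔n≤o⇒n≤o N₀ N₁₂ N≤n
          merge : ∀ a → a ℚ.+ η ℚ.+ η ≡ a ℚ.+ ½ ℚ.* ε₀
          merge a = trans (ℚ.+-assoc a η η) (cong (a ℚ.+_) (halves (½ ℚ.* ε₀)))
      in ≤-rearrange
        (ℚ.+-mono-≤
          (∣p-q∣≤r x y (½ ℚ.* ε₀)
            (subst (x ℚ.≤_) (merge y) (p₁ n (ℕ.m⊔n≤o⇒m≤o N₁ N₂ in₁₂)))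
            (subst (y ℚ.≤_) (merge x) (p₂ n (ℕ.m⊔n≤o⇒n≤o N₁ N₂ in₁₂))))
          (p₀ n (ℕ.m⊔n≤o⇒m≤o N₀ N₁₂ N≤n)))
        (solve 3 (λ d e r → d :+ con ½ :* e :+ (con ½ :* e :+ r) := d :+ (con 0ℚ :+ e) :+ r)
          refl ℚ.∣ x ℚ.- y ∣ ε₀ (seq ε n))

⟶-elim : ∀ s l → s ⟶ l → ∀ ε → 0ℚ ℚ.< ε → ∃[ N ] (∀ k → N ℕ.≤ k → Near ε (s k) l)
⟶-elim s l s⟶l ε 0<ε =
  let (N , p) = s⟶l (fromℚ ε) (ε , 0<ε , 0 , λ _ _ → ℚ.≤-reflexive (ℚ.+-identityˡ ε))
  in N , λ k N≤k → let d≤ε = <⇒≤ ∣ s k - l ∣ (fromℚ ε) (p k N≤k) in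
    (λ η 0<η → let (K , q) = d≤ε η 0<η in K , λ n K≤n →
      subst (seq (s k) n ℚ.≤_) (sym (ℚ.+-assoc (seq l n) ε η))
        (∣p-q∣≤r⇒p≤q+r (seq (s k) n) (seq l n) (ε ℚ.+ η) (q n K≤n))) ,
    (λ η 0<η → let (K , q) = d≤ε η 0<η in K , λ n K≤n →
      subst (seq l n ℚ.≤_) (sym (ℚ.+-assoc (seq (s k) n) ε η))
        (∣p-q∣≤r⇒p≤q+r (seq l n) (seq (s k) n) (ε ℚ.+ η)
          (subst (ℚ._≤ ε ℚ.+ η) (∣p-q∣≡∣q-p∣ (seq (s k) n) (seq l n)) (q n K≤n))))

-- Completeness

-- A Cauchy condition with rational centres, which supplies directly the rationals from which a
-- limit is built.
RationallyApproximable : (ℕ → ℝ) → Set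
RationallyApproximable s =
  ∀ ε → 0ℚ ℚ.< ε → ∃[ q ] ∃[ N ] (∀ k → N ℕ.≤ k → Near ε (s k) (fromℚ q))

-- The approximants to within 1/(n+1) form the Cauchy sequence of the limit.
approximable⇒convergent : ∀ s → RationallyApproximable s → ∃[ l ] (s ⟶ l)
approximable⇒convergent s h = l , ⟶-intro s l limit
  where
  r : ℕ → ℚ
  r n = proj₁ (h (1/suc n) (1/suc-pos n))

  near-r : ∀ n → ∃[ N ] (∀ k → N ℕ.≤ k → Near (1/suc n) (s k) (fromℚ (r n)))
  near-r n = proj₂ (h (1/suc n) (1/suc-pos n))

  r-near : ∀ m n → Near (1/suc m ℚ.+ 1/suc n) (fromℚ (r m)) (fromℚ (r n))
  r-near m n =
    let (N₁ , p₁) = near-r m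
        (N₂ , p₂) = near-r n
        -- The term `s k` lies beyond both thresholds, hence is near both approximants.
        k         = N₁ ℕ.⊔ N₂
    in Near-trans (fromℚ (r m)) (s k) (fromℚ (r n))
         (Near-sym (s k) (fromℚ (r m)) (p₁ k (ℕ.m≤m⊔n N₁ N₂)))
         (p₂ k (ℕ.m≤n⊔m N₁ N₂))

  r-close : ∀ m n → ℚ.∣ r m ℚ.- r n ∣ ℚ.≤ 1/suc m ℚ.+ 1/suc n
  r-close m n = ∣p-q∣≤r (r m) (r n) (1/suc m ℚ.+ 1/suc n)
    (fromℚ-cancel-≤ (r m) (r n ℚ.+ (1/suc m ℚ.+ 1/suc n)) (proj₁ (r-near m n)))
    (fromℚ-cancel-≤ (r n) (r m ℚ.+ (1/suc m ℚ.+ 1/suc n)) (proj₂ (r-near m n)))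

  within : ∀ ε → 0ℚ ℚ.< ε →
    ∃[ N ] (∀ m n → N ℕ.≤ m → N ℕ.≤ n → 1/suc m ℚ.+ 1/suc n ℚ.≤ ½ ℚ.* ε)
  within ε 0<ε =
    -- Each reciprocal is at most `ε/4`; stopping at `ε/2` leaves room for the strict inequality in
    -- `Cauchy`.
    let (N , p) = 1/suc-small (½*-pos (½*-pos 0<ε))
    in N , λ m n N≤m N≤n → subst (1/suc m ℚ.+ 1/suc n ℚ.≤_) (halves (½ ℚ.* ε))
      (ℚ.+-mono-≤ (ℚ.≤-trans (1/suc-anti-≤ N≤m) p) (ℚ.≤-trans (1/suc-anti-≤ N≤n) p))

  half< : ∀ {ε} → 0ℚ ℚ.< ε → ½ ℚ.* ε ℚ.< ε
  half< {ε} 0<ε = subst₂ ℚ._<_ (ℚ.+-identityʳ (½ ℚ.* ε)) (halves ε)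
    (ℚ.+-monoʳ-< (½ ℚ.* ε) (½*-pos 0<ε))

  l : ℝ
  l = mkℝ r λ ε 0<ε → let (N , p) = within ε 0<ε in
    N , λ m n N≤m N≤n →
      ℚ.≤-<-trans (ℚ.≤-trans (r-close m n) (p m n N≤m N≤n)) (half< 0<ε)

  r-near-l : ∀ ε → 0ℚ ℚ.< ε → ∃[ N ] (∀ n → N ℕ.≤ n → Near ε (fromℚ (r n)) l)
  r-near-l ε 0<ε = let (N , p) = within ε 0<ε in N , λ n N≤n →
    let bound : ∀ m → N ℕ.≤ m → ℚ.∣ r n ℚ.- r m ∣ ℚ.≤ ε
        bound m N≤m = ℚ.≤-trans (r-close n m)
          (ℚ.≤-trans (p n m N≤n N≤m) (ℚ.<⇒≤ (half< 0<ε)))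
    in (λ η 0<η → N , λ m N≤m → ℚ.≤-trans
         (∣p-q∣≤r⇒p≤q+r (r n) (r m) ε (bound m N≤m))
         (p≤p+q (r m ℚ.+ ε) (ℚ.<⇒≤ 0<η))) ,
       (λ η 0<η → N , λ m N≤m → ℚ.≤-trans
         (∣p-q∣≤r⇒p≤q+r (r m) (r n) ε
           (subst (ℚ._≤ ε) (∣p-q∣≡∣q-p∣ (r n) (r m)) (bound m N≤m)))
         (p≤p+q (r n ℚ.+ ε) (ℚ.<⇒≤ 0<η)))

  limit : ∀ ε → 0ℚ ℚ.< ε → ∃[ N ] (∀ k → N ℕ.≤ k → Near ε (s k) l)
  limit ε 0<ε =
    let (N₁ , small)  = 1/suc-small (½*-pos 0<ε)
        (N₂ , near-l) = r-near-l (½ ℚ.* ε) (½*-pos 0<ε)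
        -- This index makes `r n` lie within `ε/2` both of a tail of `s` and of `l`.
        n             = N₁ ℕ.⊔ N₂
        (K , near-rn) = near-r n
    in K , λ k K≤k → subst (λ δ → Near δ (s k) l) (halves ε)
      (Near-trans (s k) (fromℚ (r n)) l
        (Near-weaken (s k) (fromℚ (r n))
          (ℚ.≤-trans (1/suc-anti-≤ (ℕ.m≤m⊔n N₁ N₂)) small) (near-rn k K≤k))
        (near-l n (ℕ.m≤n⊔m N₁ N₂)))

-- Monotone sequences

mono : (s : ℕ → ℝ) → (∀ k → s k ≤ s (suc k)) → ∀ {m n} → m ℕ.≤ n → s m ≤ s n
mono s step {m} m≤n = go (ℕ.≤⇒≤′ m≤n)
  where
  go : ∀ {n} → m ℕ.≤′ n → s m ≤ s n
  go ℕ.≤′-refl            = ≤-refl (s m)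
  go {suc n} (ℕ.≤′-step h) = ≤-trans (s m) (s n) (s (suc n)) (go h) (step n)

-- From the Cauchy threshold for tolerance 1 onwards, the sequence stays within 1 of its value `c`
-- at that threshold.
rational-bounds : ∀ x → ∃[ p ] ∃[ q ] (fromℚ p ≤ x × x ≤ fromℚ q)
rational-bounds x =
  let (N , h) = cauchy x 1ℚ (ℚ.positive⁻¹ 1ℚ)
      c       = seq x N
      near : ∀ n → N ℕ.≤ n → ℚ.∣ seq x n ℚ.- c ∣ ℚ.≤ 1ℚ
      near n N≤n = ℚ.<⇒≤ (h n N N≤n ℕ.≤-refl)
  in c ℚ.- 1ℚ , c ℚ.+ 1ℚ ,
    (λ ε 0<ε → N , λ n N≤n → ≤-rearrange
      (ℚ.≤-trans (∣p-q∣≤r⇒p≤q+r c (seq x n) 1ℚ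
        (subst (ℚ._≤ 1ℚ) (∣p-q∣≡∣q-p∣ (seq x n) c) (near n N≤n)))
        (p≤p+q (seq x n ℚ.+ 1ℚ) (ℚ.<⇒≤ 0<ε)))
      (solve 3 (λ c x e → c :- con 1ℚ :+ (x :+ con 1ℚ :+ e) := c :+ (x :+ e)) refl c (seq x n) ε)) ,
    (λ ε 0<ε → N , λ n N≤n →
      ℚ.≤-trans (∣p-q∣≤r⇒p≤q+r (seq x n) c 1ℚ (near n N≤n)) (p≤p+q (c ℚ.+ 1ℚ) (ℚ.<⇒≤ 0<ε)))

-- An upper bound c that is nowhere within ε of the sequence can be lowered to c - ε;
-- this stops before the bound falls below a lower bound p of s 0.
almost-attained-bound : ExcludedMiddle 0ℓ → (s : ℕ → ℝ) → ∀ ε → 0ℚ ℚ.< ε → ∀ p → fromℚ p ≤ s 0 →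
  ∀ n c → c ℚ.≤ p ℚ.+ n · ε → (∀ k → s k ≤ fromℚ c) →
  ∃[ q ] ((∀ k → s k ≤ fromℚ q) × ∃[ N ] (fromℚ (q ℚ.- ε) ≤ s N))
-- With no lowering left, `c ≤ p`, so `c - ε` is below `s 0` and the index 0 serves.
almost-attained-bound em s ε 0<ε p p≤s₀ zero c c≤p s≤c = c , s≤c , 0 ,
  ≤-trans (fromℚ (c ℚ.- ε)) (fromℚ p) (s 0)
    (pointwise-≤ (fromℚ (c ℚ.- ε)) (fromℚ p) λ _ →
      ≤-rearrange (ℚ.+-mono-≤ c≤p (ℚ.<⇒≤ 0<ε))
        (solve 3 (λ c p e → c :- e :+ (p :+ con 0ℚ :+ e) := c :+ con 0ℚ :+ p) refl c p ε))
    p≤s₀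
almost-attained-bound em s ε 0<ε p p≤s₀ (suc n) c c≤ s≤c
  with em {∃[ N ] (fromℚ (c ℚ.- ε) < s N)}
... | yes (N , c-ε<s) = c , s≤c , N , <⇒≤ (fromℚ (c ℚ.- ε)) (s N) c-ε<s
... | no  ∄N = almost-attained-bound em s ε 0<ε p p≤s₀ n (c ℚ.- ε)
  (≤-rearrange c≤
    (solve 4 (λ c e p m → c :- e :+ (p :+ (e :+ m)) := c :+ (p :+ m)) refl c ε p (n · ε)))
  λ k → [ (λ c-ε<s → contradiction (k , c-ε<s) ∄N) , (λ s≤ → s≤) ]′
    (<-≤-total em (fromℚ (c ℚ.- ε)) (s k))

-- For each `ε` there is a rational upper bound `q` such that `q - ε` is reached at some index; by
-- monotonicity all later terms lie between `q - ε` and `q`, so `q` approximates the tail.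
monotone-convergence : ExcludedMiddle 0ℓ → (s : ℕ → ℝ) → (∀ k → s k ≤ s (suc k)) →
  ∀ B → (∀ k → s k ≤ B) → ∃[ l ] (s ⟶ l)
monotone-convergence em s step B s≤B = approximable⇒convergent s λ ε 0<ε →
  let (p , _ , p≤s₀ , _) = rational-bounds (s 0)
      (_ , c , _ , B≤c)  = rational-bounds B
      -- Lowering `c` by `ε` this many times would bring it down to `p` or below.
      (n , c-p≤nε)       = archimedean 0<ε (c ℚ.- p)
      (q , s≤q , N , q-ε≤s) = almost-attained-bound em s ε 0<ε p p≤s₀ n c
        (≤-rearrange c-p≤nε
          (solve 3 (λ c p m → c :+ m := c :- p :+ (p :+ m)) refl c p (n · ε)))
        (λ k → ≤-trans (s k) B (fromℚ c) (s≤B k) B≤c)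
  in q , N , λ k N≤k →
    x≤y⇒x≤y+q (s k) (fromℚ q) (ℚ.<⇒≤ 0<ε) (s≤q k) ,
    ≤-trans (fromℚ q) (fromℚ (q ℚ.- ε) + fromℚ ε) (s k + fromℚ ε)
      (pointwise-≤ (fromℚ q) (fromℚ (q ℚ.- ε) + fromℚ ε) λ _ →
        ℚ.≤-reflexive (solve 2 (λ q e → q := q :- e :+ e) refl q ε))
      (+-monoˡ-≤ (fromℚ (q ℚ.- ε)) (s k) (fromℚ ε)
        (≤-trans (fromℚ (q ℚ.- ε)) (s N) (s k) q-ε≤s (mono s step N≤k)))

-- Decide whether the sequence is bounded above. If not, every `B` is exceeded by some term, and by
-- monotonicity by all later ones.
monotone-dichotomy : ExcludedMiddle 0ℓ → (s : ℕ → ℝ) → (∀ k → s k ≤ s (suc k)) →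
  ∃[ l ] (s ⟶ l) ⊎ (∀ B → ∃[ N ] (∀ k → N ℕ.≤ k → B < s k))
monotone-dichotomy em s step with em {∃[ B ] (∀ k → s k ≤ B)}
... | yes (B , s≤B) = inj₁ (monotone-convergence em s step B s≤B)
... | no  unbounded = inj₂ λ B → exceeds B (em {∃[ N ] (B < s N)})
  where
  exceeds : ∀ B → _ → ∃[ N ] (∀ k → N ℕ.≤ k → B < s k)
  exceeds B (yes (N , B<s)) = N , λ k N≤k → <-≤-trans B (s N) (s k) B<s (mono s step N≤k)
  exceeds B (no ∄N) = contradiction
    (B , λ k → [ (λ B<s → contradiction (k , B<s) ∄N) , (λ s≤B → s≤B) ]′ (<-≤-total em B (s k)))
    unbounded

partialSum-∣∣-increasing : (a : ℕ → ℝ) → ∀ k →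
  partialSum (λ n → ∣ a n ∣) k ≤ partialSum (λ n → ∣ a n ∣) (suc k)
partialSum-∣∣-increasing a k =
  pointwise-≤ (partialSum (λ n → ∣ a n ∣) k) (partialSum (λ n → ∣ a n ∣) (suc k))
    λ n → p≤p+q (seq (partialSum (λ n → ∣ a n ∣) k) n) (ℚ.0≤∣p∣ (seq (a (suc k)) n))

-- The coprojector

module _ (em : ExcludedMiddle 0ℓ) (M : ℝ) (1≤M : 1ℝ ≤ M) where

  t : ℝ → ℝ
  t x = value (coprojector em M 1≤M x)

  t≤M : ∀ x → t x ≤ M
  t≤M x = upper (coprojector em M 1≤M x)

  -M≤t : ∀ x → - M ≤ t x
  -M≤t x = lower (coprojector em M 1≤M x)

  -- Clipping raises a value only up to `- M`. Together with the dual `x≤t⊎M≤t` and the bounds on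
  -- `t`, this replaces all further case analysis on `position`.
  t≤x⊎t≤-M : ∀ x → t x ≤ x ⊎ t x ≤ - M
  t≤x⊎t≤-M x = go (position em M x)
    where
    -- Abstracting the position lets `project` compute in each case.
    go : (p : Position M x) →
      value (project {M} {x} 1≤M p) ≤ x ⊎ value (project {M} {x} 1≤M p) ≤ - M
    go (inside _ _) = inj₁ (≤-refl x)
    go (above M<x)  = inj₁ (<⇒≤ M x M<x)
    go (below _)    = inj₂ (≤-refl (- M))

  x≤t⊎M≤t : ∀ x → x ≤ t x ⊎ M ≤ t x
  x≤t⊎M≤t x = go (position em M x)
    where
    go : (p : Position M x) →
      x ≤ value (project {M} {x} 1≤M p) ⊎ M ≤ value (project {M} {x} 1≤M p)
    go (inside _ _) = inj₁ (≤-refl x)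
    go (above _)    = inj₂ (≤-refl M)
    go (below x<-M) = inj₁ (<⇒≤ x (- M) x<-M)

  M≤x⇒M≤t : ∀ x → M ≤ x → M ≤ t x
  M≤x⇒M≤t x M≤x = [ ≤-trans M x (t x) M≤x , (λ M≤t → M≤t) ]′ (x≤t⊎M≤t x)

  x≤-M⇒t≤-M : ∀ x → x ≤ - M → t x ≤ - M
  x≤-M⇒t≤-M x x≤-M =
    [ (λ t≤x → ≤-trans (t x) x (- M) t≤x x≤-M) , (λ t≤-M → t≤-M) ]′ (t≤x⊎t≤-M x)

  -- If `t x ≤ - M` or `M ≤ t y`, the range of `t` already gives `t x ≤ t y`; otherwise `t x ≤ x`
  -- and `y ≤ t y` enclose the hypothesis. Applied in both directions, it preserves `Near`.
  t-lipschitz : ∀ x y {ε} → 0ℚ ℚ.< ε → x ≤ y + fromℚ ε → t x ≤ t y + fromℚ ε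
  t-lipschitz x y {ε} 0<ε x≤y+ε = go (t≤x⊎t≤-M x) (x≤t⊎M≤t y)
    where
    go : t x ≤ x ⊎ t x ≤ - M → y ≤ t y ⊎ M ≤ t y → t x ≤ t y + fromℚ ε
    go (inj₂ t≤-M) _ = x≤y⇒x≤y+q (t x) (t y) (ℚ.<⇒≤ 0<ε)
      (≤-trans (t x) (- M) (t y) t≤-M (-M≤t y))
    go (inj₁ _) (inj₂ M≤t) = x≤y⇒x≤y+q (t x) (t y) (ℚ.<⇒≤ 0<ε)
      (≤-trans (t x) M (t y) (t≤M x) M≤t)
    go (inj₁ t≤x) (inj₁ y≤t) = ≤-trans (t x) x (t y + fromℚ ε) t≤x
      (≤-trans x (y + fromℚ ε) (t y + fromℚ ε) x≤y+ε (+-monoˡ-≤ y (t y) (fromℚ ε) y≤t))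

  -- Convergence of weak projections

  weakProjection-converges : ∀ a →
    SeriesConverges a ⊎ SeriesDivergesTo+∞ a ⊎ SeriesDivergesTo-∞ a →
    WeakProjectionConverges em M 1≤M a
  weakProjection-converges a (inj₁ (l , s⟶l)) =
    coprojector em M 1≤M l , ⟶-intro (λ k → t (s k)) (t l) λ ε 0<ε →
      let (N , near) = ⟶-elim s l s⟶l ε 0<ε
      in N , λ k N≤k →
        t-lipschitz (s k) l 0<ε (proj₁ (near k N≤k)) ,
        t-lipschitz l (s k) 0<ε (proj₂ (near k N≤k))
    where
    s : ℕ → ℝ
    s = partialSum a
  weakProjection-converges a (inj₂ (inj₁ s→+∞)) =
    mk𝐀 M (-M≤M {M} 1≤M) (≤-refl M) , ⟶-intro (λ k → t (s k)) M λ ε 0<ε →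
      -- Once the partial sums exceed `M`, their images are at least `M` and at most `M`.
      let (N , M<s) = s→+∞ M
      in N , λ k N≤k →
        x≤y⇒x≤y+q (t (s k)) M (ℚ.<⇒≤ 0<ε) (t≤M (s k)) ,
        x≤y⇒x≤y+q M (t (s k)) (ℚ.<⇒≤ 0<ε) (M≤x⇒M≤t (s k) (<⇒≤ M (s k) (M<s k N≤k)))
    where
    s : ℕ → ℝ
    s = partialSum a
  weakProjection-converges a (inj₂ (inj₂ s→-∞)) =
    mk𝐀 (- M) (≤-refl (- M)) (-M≤M {M} 1≤M) , ⟶-intro (λ k → t (s k)) (- M) λ ε 0<ε →
      let (N , s<-M) = s→-∞ (- M)
      in N , λ k N≤k →
        x≤y⇒x≤y+q (t (s k)) (- M) (ℚ.<⇒≤ 0<ε)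
          (x≤-M⇒t≤-M (s k) (<⇒≤ (s k) (- M) (s<-M k N≤k))) ,
        x≤y⇒x≤y+q (- M) (t (s k)) (ℚ.<⇒≤ 0<ε) (-M≤t (s k))
    where
    s : ℕ → ℝ
    s = partialSum a

corollary1 : (em : ExcludedMiddle 0ℓ) (M : ℝ) (1≤M : 1ℝ ≤ M) (a : ℕ → ℝ) →
    WeakProjectionConvergesAbsolutely em M 1≤M a
    × (SeriesConverges a ⊎ SeriesDivergesTo+∞ a ⊎ SeriesDivergesTo-∞ a →
    WeakProjectionConverges em M 1≤M a)
corollary1 em M 1≤M a =
  weakProjection-converges em M 1≤M (λ n → ∣ a n ∣)
    ([ inj₁ , (λ s→+∞ → inj₂ (inj₁ s→+∞)) ]′
      (monotone-dichotomy em (partialSum (λ n → ∣ a n ∣)) (partialSum-∣∣-increasing a))) ,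
  weakProjection-converges em M 1≤M a
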